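{- If $n\geq 5$ and $Q_n$ is the $n$-dimensional hypercube, then $$\rho'(Q_n)\leq 4\lceil \log_2 n\rceil-2.$$
   Context: The hypercube $Q_n$ is the Cartesian product of $n$ copies of $K_2$. An edge coloring of a graph is distinguishing if no automorphism other than the identity preserves it. $D'(G)$ is the least number of colors in a distinguishing edge coloring of $G$. When $D'(G)=2$, the cost of edge-distinguishing $\rho'(G)$ is the minimum number of edges in the smaller color class over all distinguishing edge colorings of $G$ with two colors. -}

module Defs where

open import Data.Fin.Base using (Fin; zero; suc)
import Data.Fin.Properties as Fin
open import Data.List.Base using (List; []; _∷_; _++_; map; filter; length; allFin; cartesianProductWith)
open import Data.List.Membership.Propositional using (_∈_)
open import Data.List.Membership.Propositional.Properties using (∈-allFin; ∈-cartesianProductWith⁺)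
open import Data.List.Relation.Unary.All as All using ()
open import Data.List.Relation.Unary.AllPairs as AllPairs using ()
open import Data.List.Relation.Unary.Any using (here)
open import Data.List.Relation.Unary.Unique.Propositional using (Unique)
open import Data.List.Relation.Unary.Unique.Propositional.Properties using (allFin⁺; cartesianProductWith⁺)
open import Data.Nat.Base using (ℕ; zero; suc; _≤_; _⊓_)
open import Data.Product using (Σ; ∃; ∃-syntax; _×_; _,_; proj₁; proj₂)
open import Data.Vec.Base using (Vec; []; _∷_; lookup)
import Data.Vec.Properties as Vec
open import Function.Base using (_∘_)
open import Function.Bundles using (_↔_; _⇔_; Inverse; Equivalence)
open import Relation.Binary.Definitions using (DecidableEquality; Decidable; Symmetric)
open import Relation.Binary.PropositionalEquality using (_≡_; _≢_; refl; sym)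
open import Relation.Nullary using (¬_; Dec; yes; no)
open import Relation.Nullary.Decidable using (_×-dec_; _→-dec_; ¬?)

record FiniteGraph : Set₁ where
  infix 4 _~_ _~?_ _≟_
  field
    V        : Set
    _≟_      : DecidableEquality V
    vertices : List V
    complete : ∀ v → v ∈ vertices
    unique   : Unique vertices
    _~_      : V → V → Set
    _~?_     : Decidable _~_
    ~-sym    : Symmetric _~_
    ~-irrefl : ∀ {v} → ¬ (v ~ v)

K : ℕ → FiniteGraph
K m = record
  { V        = Fin m
  ; _≟_      = Fin._≟_
  ; vertices = allFin m
  ; complete = ∈-allFin
  ; unique   = allFin⁺ m
  ; _~_      = _≢_
  ; _~?_     = λ u v → ¬? (u Fin.≟ v)
  ; ~-sym    = λ u≢v → u≢v ∘ sym
  ; ~-irrefl = λ v≢v → v≢v refl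
  }

module _ {A : Set} (xs : List A) where

  tuples : ∀ n → List (Vec A n)
  tuples zero    = [] ∷ []
  tuples (suc n) = cartesianProductWith _∷_ xs (tuples n)

  tuples-complete : (∀ x → x ∈ xs) → ∀ n (t : Vec A n) → t ∈ tuples n
  tuples-complete h zero    []      = here refl
  tuples-complete h (suc n) (x ∷ t) =
    ∈-cartesianProductWith⁺ _∷_ (h x) (tuples-complete h n t)

  tuples-unique : Unique xs → ∀ n → Unique (tuples n)
  tuples-unique h zero    = All.[] AllPairs.∷ AllPairs.[]
  tuples-unique h (suc n) =
    cartesianProductWith⁺ _∷_ Vec.∷-injective h (tuples-unique h n)

-- The Cartesian product of n copies of G: two tuples are adjacent when they
-- are adjacent in one coordinate and agree in all the others.
infixl 8 _□^_
_□^_ : FiniteGraph → ℕ → FiniteGraph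
G □^ n = record
  { V        = Vec V n
  ; _≟_      = Vec.≡-dec _≟_
  ; vertices = tuples vertices n
  ; complete = tuples-complete vertices complete n
  ; unique   = tuples-unique vertices unique n
  ; _~_      = λ x y → ∃[ i ] (lookup x i ~ lookup y i
                               × (∀ j → j ≢ i → lookup x j ≡ lookup y j))
  ; _~?_     = λ x y → Fin.any? λ i → (lookup x i ~? lookup y i)
                 ×-dec Fin.all? λ j → ¬? (j Fin.≟ i) →-dec (lookup x j ≟ lookup y j)
  ; ~-sym    = λ (i , e , eqs) → i , ~-sym e , λ j j≢i → sym (eqs j j≢i)
  ; ~-irrefl = λ (i , e , eqs) → ~-irrefl e
  }
  where open FiniteGraph G

Q : ℕ → FiniteGraph
Q n = K 2 □^ n

-- All pairs of entries at positions i < j.  On a list without repetitions,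
-- every unordered pair of distinct entries is listed exactly once.
unorderedPairs : {A : Set} → List A → List (A × A)
unorderedPairs []       = []
unorderedPairs (x ∷ xs) = map (x ,_) xs ++ unorderedPairs xs

module _ (G : FiniteGraph) where
  open FiniteGraph G

  record Automorphism : Set where
    field
      bijection : V ↔ V
    open Inverse bijection public using (to; from)
    field
      adjacency : ∀ {u v} → (u ~ v) ⇔ (to u ~ to v)

    to-~ : ∀ {u v} → u ~ v → to u ~ to v
    to-~ = Equivalence.to adjacency

  -- A map from edges to k colours.  The adjacency proof is irrelevant and the
  -- colour is symmetric, so it depends only on the unordered pair {u , v}.
  record EdgeColouring (k : ℕ) : Set where
    field
      colour     : ∀ u v → .(u ~ v) → Fin k
      colour-sym : ∀ u v .(e : u ~ v) → colour u v e ≡ colour v u (~-sym e)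

  module _ {k : ℕ} (c : EdgeColouring k) where
    open EdgeColouring c

    Preserves : Automorphism → Set
    Preserves φ = ∀ u v (e : u ~ v) → colour (to u) (to v) (to-~ e) ≡ colour u v e
      where open Automorphism φ

    Distinguishing : Set
    Distinguishing = ∀ φ → Preserves φ → ∀ v → Automorphism.to φ v ≡ v

    HasColour : Fin k → V × V → Set
    HasColour i (u , v) = Σ (u ~ v) λ e → colour u v e ≡ i

    hasColour? : ∀ i p → Dec (HasColour i p)
    hasColour? i (u , v) with u ~? v
    ... | no ¬e = no (¬e ∘ proj₁)
    ... | yes e with colour u v e Fin.≟ i
    ...   | yes p = yes (e , p)
    ...   | no ¬p = no (¬p ∘ proj₂)

    classSize : Fin k → ℕ
    classSize i = length (filter (hasColour? i) (unorderedPairs vertices))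

  smallerClass : EdgeColouring 2 → ℕ
  smallerClass c = classSize c zero ⊓ classSize c (suc zero)

  -- D′(G) = d
  record DistinguishingIndex (d : ℕ) : Set where
    field
      attained : ∃ λ (c : EdgeColouring d) → Distinguishing c
      minimal  : ∀ k (c : EdgeColouring k) → Distinguishing c → d ≤ k

  -- ρ′(G) = r.  As ρ′ is only defined when D′(G) = 2, this is part of the claim
  -- that ρ′(G) has a value.
  record EdgeDistinguishingCost (r : ℕ) : Set where
    field
      index-two : DistinguishingIndex 2
      attained  : ∃ λ (c : EdgeColouring 2) → Distinguishing c × smallerClass c ≡ r
      minimal   : ∀ (c : EdgeColouring 2) → Distinguishing c → r ≤ smallerClass c

{-# OPTIONS --safe #-}
module Submission where

-- Let m = ⌈log₂ n⌉ ≥ 3 and write vertices of Qₙ as w z with w of length m.  Let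
-- wⱼ = 1ʲ 0ᵐ⁻ʲ.  Take the path w₀ 0 , … , wₘ 0, two pendant edges at w₀ 0, and
-- for every i < m the translate {wᵢ rᵢ , wᵢ₊₁ rᵢ} of the i-th path edge, where
-- rᵢ collects the i-th binary digits of the numbers c < n - m: at most
-- 2m + 2 ≤ 4m - 2 edges in all.  In this subgraph w₀ 0 is the only vertex of
-- degree 3, so a symmetry fixes it and then, step by step, the whole path; hence
-- it preserves each of the first m coordinates.  It therefore maps the i-th
-- translate to one of the two rungs in direction i and, being injective, fixes
-- wᵢ rᵢ.  As the numbers c have distinct binary expansions, no two of the
-- remaining coordinates can be exchanged, and the symmetry is the identity.
--
-- The cost exists because it is decidable whether a given list of edges is
-- preserved only by the identity, so that the least size can be searched for.

open import Defs
open import Data.Nat using (ℕ; zero; suc; pred; _+_; _≤_; _<_; _*_; _∸_; _^_; ∣_-_∣;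
  ⌊_/2⌋; ⌈_/2⌉; z≤n; s≤s)
import Data.Nat.Properties as ℕ
open import Data.Nat.Induction using (Acc; acc; <-wellFounded)
open import Data.Nat.Logarithm using (⌈log₂_⌉; ⌈log₂⌉-mono-≤; ⌈log₂2^n⌉≡n)
open import Data.Nat.Logarithm.Core using (⌈log2⌉)
open import Data.Nat.Solver using (module +-*-Solver)
open import Data.Fin.Base as Fin using (Fin; zero; suc; toℕ)
import Data.Fin.Properties as Fin
open import Data.List.Base as List using (List; []; _∷_; length; filter)
import Data.List.Properties as List
import Data.List.Membership.DecPropositional as DecMembership
open import Data.List.Membership.Propositional using (_∈_; lose)
open import Data.List.Membership.Propositional.Properties
open import Data.List.Relation.Unary.All as All using (All)
import Data.List.Relation.Unary.All.Properties as All
open import Data.List.Relation.Unary.AllPairs using (AllPairs; []; _∷_)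
import Data.List.Relation.Unary.AllPairs.Properties as AllPairs
open import Data.List.Relation.Unary.Any as Any using (here; there; any?)
import Data.List.Relation.Unary.Any.Properties as Any
open import Data.List.Relation.Unary.Unique.Propositional using (Unique)
open import Data.Product using (∃-syntax; _×_; _,_; proj₁; proj₂; swap)
open import Data.Product.Properties as × using (,-injectiveʳ)
open import Data.Sum using (_⊎_; inj₁; inj₂; [_,_]′)
import Data.Sum as Sum
open import Data.Vec.Base as Vec using (Vec; []; _∷_; _++_; lookup; tabulate; replicate; fromList; toList;
  _[_]%=_)
import Data.Vec.Properties as Vec
open import Function.Base using (_∘_; id)
open import Function.Bundles using (mk↔ₛ′; mk⇔; _⇔_; Inverse; Equivalence)
open import Relation.Binary.Definitions using (tri<; tri≈; tri>)
open import Relation.Binary.PropositionalEquality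
open import Relation.Nullary using (¬_; Dec; yes; no; contradiction)
open import Relation.Nullary.Decidable using (decidable-stable; ¬?; map′; _×-dec_; _→-dec_; _⊎-dec_)
open import Relation.Unary using (Decidable)

private variable
  A : Set

-- Counting by representatives, unordered pairs, and finite search

AllPairs-lookup : ∀ {R : A → A → Set} {xs} → AllPairs R xs → ∀ {i j} → i Fin.< j →
                  R (List.lookup xs i) (List.lookup xs j)
AllPairs-lookup (rs ∷ _)  {zero}  {suc j} _         = All.lookup rs (∈-lookup j)
AllPairs-lookup (_ ∷ rss) {suc i} {suc j} (s≤s i<j) = AllPairs-lookup rss i<j

module _ {A B : Set} {R : A → A → Set} (S : A → B → Set)
         (clash : ∀ {x y b} → S x b → S y b → ¬ R x y) where

  -- Sending each position of `xs` to the position of its representative in `ys` is injective. As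
  -- `AllPairs` relates only earlier to later entries, a collision is refuted in whichever order
  -- applies.
  length-≤-representatives : ∀ {xs ys} → AllPairs R xs →
    (∀ {x} → x ∈ xs → ∃[ b ] (b ∈ ys × S x b)) → length xs ≤ length ys
  length-≤-representatives {xs} {ys} pairs rep = Fin.injective⇒≤ injective
    where
    index : Fin (length xs) → Fin (length ys)
    index i = Any.index (proj₁ (proj₂ (rep (∈-lookup {xs = xs} i))))

    represents : ∀ i → S (List.lookup xs i) (List.lookup ys (index i))
    represents i = let _ , b∈ys , s = rep (∈-lookup {xs = xs} i)
                   in subst (S _) (Any.lookup-index b∈ys) s

    injective : ∀ {i j} → index i ≡ index j → i ≡ j
    injective {i} {j} eq with Fin.<-cmp i j
    ... | tri≈ _ i≡j _ = i≡j
    ... | tri< i<j _ _ = contradiction (AllPairs-lookup pairs i<j)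
      (clash (represents i) (subst (S _ ∘ List.lookup ys) (sym eq) (represents j)))
    ... | tri> _ _ j<i = contradiction (AllPairs-lookup pairs j<i)
      (clash (represents j) (subst (S _ ∘ List.lookup ys) eq (represents i)))

∈-unorderedPairs⁻ : ∀ (xs : List A) {u v} → (u , v) ∈ unorderedPairs xs → u ∈ xs × v ∈ xs
∈-unorderedPairs⁻ (x ∷ xs) p with ∈-++⁻ (List.map (x ,_) xs) p
... | inj₁ q with _ , v∈xs , refl ← ∈-map⁻ (x ,_) q = here refl , there v∈xs
... | inj₂ q = let u∈xs , v∈xs = ∈-unorderedPairs⁻ xs q in there u∈xs , there v∈xs

∈-unorderedPairs⁺ : ∀ {xs : List A} {u v} → u ≢ v → u ∈ xs → v ∈ xs →
                    (u , v) ∈ unorderedPairs xs ⊎ (v , u) ∈ unorderedPairs xs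
∈-unorderedPairs⁺ u≢v (here refl) (here refl) = contradiction refl u≢v
∈-unorderedPairs⁺ u≢v (here refl) (there v∈)  = inj₁ (∈-++⁺ˡ (∈-map⁺ (_ ,_) v∈))
∈-unorderedPairs⁺ u≢v (there u∈)  (here refl) = inj₂ (∈-++⁺ˡ (∈-map⁺ (_ ,_) u∈))
∈-unorderedPairs⁺ {xs = x ∷ xs} u≢v (there u∈) (there v∈) =
  Sum.map (∈-++⁺ʳ (List.map (x ,_) xs)) (∈-++⁺ʳ (List.map (x ,_) xs)) (∈-unorderedPairs⁺ u≢v u∈ v∈)

DifferentPairs : A × A → A × A → Set
DifferentPairs p q = p ≢ q × p ≢ swap q

unorderedPairs-different : ∀ {xs : List A} → Unique xs → AllPairs DifferentPairs (unorderedPairs xs)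
unorderedPairs-different [] = []
unorderedPairs-different {xs = x ∷ xs} (x∉xs ∷ xs!) = AllPairs.++⁺
  (firsts x∉xs xs!)
  (unorderedPairs-different xs!)
  (All.map⁺ (All.tabulate λ _ → All.tabulate λ q∈ → let u∈ , v∈ = ∈-unorderedPairs⁻ xs q∈ in
    (λ { refl → All.lookup x∉xs u∈ refl }) , (λ { refl → All.lookup x∉xs v∈ refl })))
  where
  firsts : ∀ {ys} → All (x ≢_) ys → Unique ys → AllPairs DifferentPairs (List.map (x ,_) ys)
  firsts All.[] [] = []
  firsts (x≢y All.∷ x∉ys) (y∉ys ∷ ys!) =
    All.map⁺ (All.map (λ y≢z → y≢z ∘ ,-injectiveʳ , x≢y ∘ sym ∘ ,-injectiveʳ) y∉ys)
    ∷ firsts x∉ys ys!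

∀-finite? : ∀ {P : A → Set} (xs : List A) → (∀ x → x ∈ xs) → Decidable P → Dec (∀ x → P x)
∀-finite? xs complete P? =
  map′ (λ ps x → All.lookup ps (complete x)) (λ p → All.tabulate λ {x} _ → p x) (All.all? P? xs)

least : ∀ {P : ℕ → Set} → Decidable P → ∀ b → P b →
        ∃[ r ] (r ≤ b × P r × (∀ s → P s → r ≤ s))
least {P} P? b pb with P? 0
least     P? b       pb | yes p0 = 0 , z≤n , p0 , λ _ _ → z≤n
least     P? zero    pb | no ¬p0 = contradiction pb ¬p0
least {P} P? (suc b) pb | no ¬p0 with least {P ∘ suc} (P? ∘ suc) b pb
... | r , r≤b , pr , minimal = suc r , s≤s r≤b , pr , λ where
  zero    p0 → contradiction p0 ¬p0
  (suc s) ps → s≤s (minimal s ps)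

-- Rigid edge lists: deciding rigidity

module _ (G : FiniteGraph) where
  open FiniteGraph G
  open DecMembership (×.≡-dec _≟_ _≟_) using (_∈?_)

  -- L lists undirected edges, each in either orientation.
  Marked : List (V × V) → V → V → Set
  Marked L u v = (u , v) ∈ L ⊎ (v , u) ∈ L

  marked? : ∀ L u v → Dec (Marked L u v)
  marked? L u v = ((u , v) ∈? L) ⊎-dec ((v , u) ∈? L)

  -- One implication suffices, because `Symmetry` asks the same of the inverse map.
  Keeps : List (V × V) → (V → V) → Set
  Keeps L f = ∀ u v → u ~ v → f u ~ f v × (Marked L u v → Marked L (f u) (f v))

  record Symmetry (L : List (V × V)) (f g : V → V) : Set where
    constructor symmetry
    field
      g∘f     : ∀ v → g (f v) ≡ v
      f∘g     : ∀ v → f (g v) ≡ v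
      keeps   : Keeps L f
      keeps⁻¹ : Keeps L g

    automorphism : Automorphism G
    automorphism = record
      { bijection = mk↔ₛ′ f g f∘g g∘f
      ; adjacency = λ {u} {v} → mk⇔ (λ e → proj₁ (keeps u v e))
          (λ e → subst₂ _~_ (g∘f u) (g∘f v) (proj₁ (keeps⁻¹ (f u) (f v) e)))
      }

  -- Quantifying over bare functions lets a symmetry be replaced by pointwise equal tables when
  -- rigidity is decided.
  Rigid : List (V × V) → Set
  Rigid L = ∀ f g → Symmetry L f g → ∀ v → f v ≡ v

  Keeps-resp-≗ : ∀ {L f f′} → (∀ v → f v ≡ f′ v) → Keeps L f → Keeps L f′
  Keeps-resp-≗ {L} eq k u v e =
    let e′ , m = k u v e
    in subst₂ _~_ (eq u) (eq v) e′ , λ m₀ → subst₂ (Marked L) (eq u) (eq v) (m m₀)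

  keeps? : ∀ L f → Dec (Keeps L f)
  keeps? L f = ∀-finite? vertices complete λ u → ∀-finite? vertices complete λ v →
    (u ~? v) →-dec ((f u ~? f v) ×-dec (marked? L u v →-dec marked? L (f u) (f v)))

  symmetry? : ∀ L f g → Dec (Symmetry L f g)
  symmetry? L f g =
    map′ (λ (a , b , c , d) → symmetry a b c d) (λ (symmetry a b c d) → a , b , c , d)
      (∀-finite? vertices complete (λ v → g (f v) ≟ v) ×-dec
       ∀-finite? vertices complete (λ v → f (g v) ≟ v) ×-dec
       keeps? L f ×-dec keeps? L g)

  private
    -- A function stored by its values along `vertices`; unlike functions, tables can be enumerated.
    Table : Set
    Table = Vec V (length vertices)

    ⟦_⟧ : Table → V → V
    ⟦ t ⟧ v = lookup t (Any.index (complete v))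

    table : (V → V) → Table
    table f = tabulate (f ∘ List.lookup vertices)

    ⟦table⟧ : ∀ f v → f v ≡ ⟦ table f ⟧ v
    ⟦table⟧ f v = trans (cong f (Any.lookup-index (complete v)))
                        (sym (Vec.lookup∘tabulate _ (Any.index (complete v))))

    ∀-table? : ∀ {P : Table → Set} → Decidable P → Dec (∀ t → P t)
    ∀-table? = ∀-finite? (tuples vertices _) (tuples-complete vertices complete _)

  rigid? : ∀ L → Dec (Rigid L)
  rigid? L = map′ fromTables (λ rigid t t′ → rigid ⟦ t ⟧ ⟦ t′ ⟧)
    (∀-table? λ t → ∀-table? λ t′ →
      symmetry? L ⟦ t ⟧ ⟦ t′ ⟧ →-dec ∀-finite? vertices complete (λ v → ⟦ t ⟧ v ≟ v))
    where
    fromTables : (∀ t t′ → Symmetry L ⟦ t ⟧ ⟦ t′ ⟧ → ∀ v → ⟦ t ⟧ v ≡ v) → Rigid L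
    fromTables h f g (symmetry g∘f f∘g k k⁻¹) v =
      trans (⟦table⟧ f v) (h (table f) (table g) sym′ v)
      where
      compose : ∀ f g → (∀ v → g (f v) ≡ v) → ∀ v → ⟦ table g ⟧ (⟦ table f ⟧ v) ≡ v
      compose f g eq v =
        trans (sym (trans (cong g (⟦table⟧ f v)) (⟦table⟧ g _))) (eq v)

      sym′ : Symmetry L ⟦ table f ⟧ ⟦ table g ⟧
      sym′ = symmetry (compose f g g∘f) (compose g f f∘g)
                      (Keeps-resp-≗ (⟦table⟧ f) k) (Keeps-resp-≗ (⟦table⟧ g) k⁻¹)

  -- Two-colourings versus rigid edge lists

  module _ (c : EdgeColouring G 2) where
    open EdgeColouring c

    -- `L` may repeat an edge or contain both of its orientations; only the undirected edges count.
    IsClass : Fin 2 → List (V × V) → Set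
    IsClass i L = ∀ u v (e : u ~ v) → Marked L u v ⇔ colour u v e ≡ i

    class : Fin 2 → List (V × V)
    class i = filter (hasColour? G c i) (unorderedPairs vertices)

    isClass-class : ∀ i → IsClass i (class i)
    isClass-class i u v e = mk⇔ [ marked⇒ , (λ p → trans (colour-sym u v e) (marked⇒ p)) ]′ ⇒marked
      where
      marked⇒ : ∀ {u v} .{e : u ~ v} → (u , v) ∈ class i → colour u v e ≡ i
      marked⇒ p = proj₂ (proj₂ (∈-filter⁻ (hasColour? G c i) {xs = unorderedPairs vertices} p))

      ⇒marked : colour u v e ≡ i → Marked (class i) u v
      ⇒marked eq with ∈-unorderedPairs⁺ (λ { refl → ~-irrefl e }) (complete u) (complete v)
      ... | inj₁ p = inj₁ (∈-filter⁺ (hasColour? G c i) p (e , eq))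
      ... | inj₂ p = inj₂ (∈-filter⁺ (hasColour? G c i) p (~-sym e , trans (sym (colour-sym u v e)) eq))

    module _ {i : Fin 2} {L : List (V × V)} (isClass : IsClass i L) where

      rigid⇒distinguishing : Rigid L → Distinguishing G c
      rigid⇒distinguishing rigid φ preserved = rigid to from record
        { g∘f     = Inverse.strictlyInverseʳ bijection
        ; f∘g     = Inverse.strictlyInverseˡ bijection
        ; keeps   = λ u v e → to-~ e , λ m → Equivalence.from (isClass _ _ (to-~ e))
                      (trans (preserved u v e) (Equivalence.to (isClass u v e) m))
        ; keeps⁻¹ = λ u v e → from-~ u v e , λ m → Equivalence.from (isClass _ _ (from-~ u v e))
                      (trans (trans (sym (preserved _ _ (from-~ u v e))) (colour-to∘from u v e))
                             (Equivalence.to (isClass u v e) m))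
        }
        where
        open Automorphism φ
        to∘from : ∀ v → to (from v) ≡ v
        to∘from = Inverse.strictlyInverseˡ bijection

        from-~ : ∀ u v → u ~ v → from u ~ from v
        from-~ u v e = Equivalence.from adjacency (subst₂ _~_ (sym (to∘from u)) (sym (to∘from v)) e)

        colour-≡ : ∀ {u u′ v v′} → u ≡ u′ → v ≡ v′ → .{e : u ~ v} .{e′ : u′ ~ v′} →
                   colour u v e ≡ colour u′ v′ e′
        colour-≡ refl refl = refl

        colour-to∘from : ∀ u v (e : u ~ v) →
          colour (to (from u)) (to (from v)) (to-~ (from-~ u v e)) ≡ colour u v e
        colour-to∘from u v e = colour-≡ (to∘from u) (to∘from v)

      -- With two colours, one class determines the whole colouring, so a symmetry of `L` preserves
      -- both classes.
      distinguishing⇒rigid : Distinguishing G c → Rigid L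
      distinguishing⇒rigid dist f g s = dist automorphism preserved
        where
        open Symmetry s

        Fin2-≡ : ∀ {x y i : Fin 2} → (x ≡ i → y ≡ i) → (y ≡ i → x ≡ i) → x ≡ y
        Fin2-≡ {zero}     {zero}     _ _ = refl
        Fin2-≡ {suc zero} {suc zero} _ _ = refl
        Fin2-≡ {zero}     {suc zero} {zero}     p q = sym (p refl)
        Fin2-≡ {zero}     {suc zero} {suc zero} p q = q refl
        Fin2-≡ {suc zero} {zero}     {zero}     p q = q refl
        Fin2-≡ {suc zero} {zero}     {suc zero} p q = sym (p refl)

        preserved : Preserves G c automorphism
        preserved u v e = Fin2-≡
          (λ eq → Equivalence.to (isClass u v e) (subst₂ (Marked L) (g∘f u) (g∘f v)
            (proj₂ (keeps⁻¹ _ _ e′) (Equivalence.from (isClass _ _ e′) eq))))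
          (λ eq → Equivalence.to (isClass _ _ e′) (proj₂ (keeps u v e) (Equivalence.from (isClass u v e) eq)))
          where e′ = proj₁ (keeps u v e)

  markedColouring : List (V × V) → EdgeColouring G 2
  markedColouring L = record
    { colour     = λ u v _ → bit (marked? L u v)
    ; colour-sym = λ u v _ → bit-cong (marked? L u v) (marked? L v u) Sum.swap Sum.swap
    }
    where
    bit : ∀ {P : Set} → Dec P → Fin 2
    bit (yes _) = zero
    bit (no _)  = suc zero

    bit-cong : ∀ {P P′ : Set} (d : Dec P) (d′ : Dec P′) → (P → P′) → (P′ → P) → bit d ≡ bit d′
    bit-cong (yes _) (yes _) _ _ = refl
    bit-cong (no _)  (no _)  _ _ = refl
    bit-cong (yes p) (no ¬p) f _ = contradiction (f p) ¬p
    bit-cong (no ¬p) (yes p) _ g = contradiction (g p) ¬p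

  markedColouring-isClass : ∀ L → IsClass (markedColouring L) zero L
  markedColouring-isClass L u v e with marked? L u v
  ... | yes m = mk⇔ (λ _ → refl) (λ _ → m)
  ... | no ¬m = mk⇔ (λ m → contradiction m ¬m) (λ ())

  -- Each edge of the class occurs in `L` in some orientation, and different unordered pairs cannot
  -- share an entry. Repetitions in `L` make this only an inequality.
  classSize-≤-length : ∀ c {i L} → IsClass c i L → classSize G c i ≤ length L
  classSize-≤-length c {i} {L} isClass = length-≤-representatives
    (λ p b → p ≡ b ⊎ p ≡ swap b)
    (λ where
      (inj₁ refl) (inj₁ refl) (p≢q , _) → p≢q refl
      (inj₁ refl) (inj₂ refl) (_ , p≢q) → p≢q refl
      (inj₂ refl) (inj₁ refl) (_ , p≢q) → p≢q refl
      (inj₂ refl) (inj₂ refl) (p≢q , _) → p≢q refl)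
    (AllPairs.filter⁺ (hasColour? G c i) (unorderedPairs-different unique))
    representative
    where
    representative : ∀ {p} → p ∈ class c i → ∃[ b ] (b ∈ L × (p ≡ b ⊎ p ≡ swap b))
    representative {u , v} p∈ with ∈-filter⁻ (hasColour? G c i) {xs = unorderedPairs vertices} p∈
    ... | _ , e , eq with Equivalence.from (isClass u v e) eq
    ... | inj₁ m = _ , m , inj₁ refl
    ... | inj₂ m = _ , m , inj₂ refl

  smallerClass-markedColouring : ∀ L → smallerClass G (markedColouring L) ≤ length L
  smallerClass-markedColouring L = ℕ.≤-trans (ℕ.m⊓n≤m _ _)
    (classSize-≤-length (markedColouring L) (markedColouring-isClass L))

  markedColouring-distinguishing : ∀ {L} → Rigid L → Distinguishing G (markedColouring L)
  markedColouring-distinguishing {L} =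
    rigid⇒distinguishing (markedColouring L) (markedColouring-isClass L)

  class-rigid : ∀ c → Distinguishing G c → ∃[ L ] (Rigid L × length L ≡ smallerClass G c)
  class-rigid c dist with ℕ.⊓-sel (classSize G c zero) (classSize G c (suc zero))
  ... | inj₁ eq = class c zero ,
    distinguishing⇒rigid c (isClass-class c zero) dist , sym eq
  ... | inj₂ eq = class c (suc zero) ,
    distinguishing⇒rigid c (isClass-class c (suc zero)) dist , sym eq

  RigidOfSize : ℕ → Set
  RigidOfSize r = ∃[ L ] (Rigid L × length L ≡ r)

  -- Only lists of the exact length r need to be searched: the least such r is
  -- the cost, since a rigid L₀ of least length is a class of markedColouring L₀.
  rigidOfSize? : Decidable RigidOfSize
  rigidOfSize? r = map′ from-∈ to-∈ (any? (rigid? ∘ toList) candidates)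
    where
    pairs : List (V × V)
    pairs = List.cartesianProduct vertices vertices

    candidates : List (Vec (V × V) r)
    candidates = tuples pairs r

    pairs-complete : ∀ p → p ∈ pairs
    pairs-complete (u , v) = ∈-cartesianProduct⁺ (complete u) (complete v)

    from-∈ : Any.Any (Rigid ∘ toList) candidates → RigidOfSize r
    from-∈ a = let t , rigid = Any.satisfied a in toList t , rigid , Vec.length-toList t

    to-∈ : RigidOfSize r → Any.Any (Rigid ∘ toList) candidates
    to-∈ (L , rigid , refl) = lose (tuples-complete pairs pairs-complete _ (fromList L))
      (subst Rigid (sym (Vec.toList∘fromList L)) rigid)

  -- A colouring without colours forces the graph to be edgeless, and with a single colour all edges
  -- look alike; either way the nontrivial `φ` is preserved.
  two≤colours : (φ : Automorphism G) → ∃[ v ] Automorphism.to φ v ≢ v →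
                ∀ k (c : EdgeColouring G k) → Distinguishing G c → 2 ≤ k
  two≤colours φ (v , moved) zero c dist =
    contradiction (dist φ (λ u v e → contradiction (EdgeColouring.colour c u v e) λ ()) v) moved
  two≤colours φ (v , moved) (suc zero) c dist =
    contradiction (dist φ (λ u v e → Fin1-≡ _ _) v) moved
    where
    Fin1-≡ : (x y : Fin 1) → x ≡ y
    Fin1-≡ zero zero = refl
  two≤colours φ _ (suc (suc k)) _ _ = s≤s (s≤s z≤n)

  cost-≤ : (φ : Automorphism G) → ∃[ v ] Automorphism.to φ v ≢ v →
           ∀ L → Rigid L → ∃[ r ] (EdgeDistinguishingCost G r × r ≤ length L)
  cost-≤ φ moved L rigid
    with least rigidOfSize? (length L) (L , rigid , refl)
  ... | r , r≤ , (L₀ , rigid₀ , refl) , minimal = r , record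
    { index-two = record
        { attained = markedColouring L₀ , distinguishing₀
        ; minimal  = two≤colours φ moved }
    ; attained  = markedColouring L₀ , distinguishing₀ ,
        -- The smaller class has at most as many edges as `L₀` has entries; being itself a rigid
        -- list, it cannot be shorter than the least length.
        ℕ.≤-antisym (smallerClass-markedColouring L₀) (bound _ distinguishing₀)
    ; minimal   = bound
    } , r≤
    where
    distinguishing₀ : Distinguishing G (markedColouring L₀)
    distinguishing₀ = markedColouring-distinguishing rigid₀

    bound : ∀ c → Distinguishing G c → length L₀ ≤ smallerClass G c
    bound c dist = minimal _ (class-rigid c dist)

-- Symmetries of the hypercube

lookup-ext : ∀ {n} {x y : Vec A n} → (∀ i → lookup x i ≡ lookup y i) → x ≡ y
lookup-ext eq =
  trans (sym (Vec.tabulate∘lookup _)) (trans (Vec.tabulate-cong eq) (Vec.tabulate∘lookup _))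

opposite≢ : ∀ (b : Fin 2) → Fin.opposite b ≢ b
opposite≢ zero       ()
opposite≢ (suc zero) ()

≢⇒≡opposite : ∀ {a b : Fin 2} → a ≢ b → b ≡ Fin.opposite a
≢⇒≡opposite {zero}     {zero}     a≢b = contradiction refl a≢b
≢⇒≡opposite {zero}     {suc zero} _   = refl
≢⇒≡opposite {suc zero} {zero}     _   = refl
≢⇒≡opposite {suc zero} {suc zero} a≢b = contradiction refl a≢b

flip : ∀ {n} → Fin n → Vec (Fin 2) n → Vec (Fin 2) n
flip i x = x [ i ]%= Fin.opposite

flip-involutive : ∀ {n} (i : Fin n) x → flip i (flip i x) ≡ x
flip-involutive i x = trans (Vec.updateAt-updateAt i x)
  (trans (Vec.updateAt-cong i Fin.opposite-involutive x) (Vec.updateAt-id i x))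

lookup-flip-≢ : ∀ {n} (i : Fin n) x → lookup (flip i x) i ≢ lookup x i
lookup-flip-≢ i x eq = opposite≢ _ (trans (sym (Vec.lookup∘updateAt i x)) eq)

flip-++ˡ : ∀ {m k} (i : Fin m) (w : Vec (Fin 2) m) (z : Vec (Fin 2) k) →
           flip (i Fin.↑ˡ k) (w ++ z) ≡ flip i w ++ z
flip-++ˡ zero    (_ ∷ _) z = refl
flip-++ˡ (suc i) (b ∷ w) z = cong (b ∷_) (flip-++ˡ i w z)

-- The Hamming distance: each summand is 0 or 1.
dist : ∀ {n} → Vec (Fin 2) n → Vec (Fin 2) n → ℕ
dist []      []      = 0
dist (a ∷ x) (b ∷ y) = ∣ toℕ a - toℕ b ∣ + dist x y

dist-refl : ∀ {n} (x : Vec (Fin 2) n) → dist x x ≡ 0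
dist-refl []      = refl
dist-refl (a ∷ x) = cong₂ _+_ (ℕ.∣n-n∣≡0 (toℕ a)) (dist-refl x)

dist≡0⇒≡ : ∀ {n} (x y : Vec (Fin 2) n) → dist x y ≡ 0 → x ≡ y
dist≡0⇒≡ []      []      _  = refl
dist≡0⇒≡ (a ∷ x) (b ∷ y) eq = cong₂ _∷_
  (Fin.toℕ-injective (ℕ.∣m-n∣≡0⇒m≡n (ℕ.m+n≡0⇒m≡0 _ eq)))
  (dist≡0⇒≡ x y (ℕ.m+n≡0⇒n≡0 _ eq))

dist-flip-agree : ∀ {n} i (x y : Vec (Fin 2) n) → lookup x i ≡ lookup y i →
                  dist (flip i x) y ≡ suc (dist x y)
dist-flip-agree zero    (zero     ∷ x) (_ ∷ y) refl = refl
dist-flip-agree zero    (suc zero ∷ x) (_ ∷ y) refl = refl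
dist-flip-agree (suc i) (a ∷ x) (b ∷ y) eq =
  trans (cong (_ +_) (dist-flip-agree i x y eq)) (ℕ.+-suc _ _)

dist-flip-differ : ∀ {n} i (x y : Vec (Fin 2) n) → lookup x i ≢ lookup y i →
                   dist x y ≡ suc (dist (flip i x) y)
dist-flip-differ i x y neq = trans (cong (λ x → dist x y) (sym (flip-involutive i x)))
  (dist-flip-agree i (flip i x) y
    (trans (Vec.lookup∘updateAt i x) (sym (≢⇒≡opposite neq))))

dist-flip-≤ : ∀ {n} i (x y : Vec (Fin 2) n) → dist (flip i x) y ≤ suc (dist x y)
dist-flip-≤ i x y with lookup x i Fin.≟ lookup y i
... | yes eq = ℕ.≤-reflexive (dist-flip-agree i x y eq)
... | no neq = ℕ.m≤n⇒m≤1+n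
  (ℕ.≤-trans (ℕ.n≤1+n _) (ℕ.≤-reflexive (sym (dist-flip-differ i x y neq))))

module _ {n : ℕ} where
  open FiniteGraph (Q n)

  0ⁿ : V
  0ⁿ = replicate n zero

  ~⇒flip : ∀ x y → x ~ y → ∃[ i ] (y ≡ flip i x)
  ~⇒flip x y (i , x≢y , eq) = i , lookup-ext λ j → lookup-y j
    where
    lookup-y : ∀ j → lookup y j ≡ lookup (flip i x) j
    lookup-y j with j Fin.≟ i
    ... | yes refl = trans (≢⇒≡opposite x≢y) (sym (Vec.lookup∘updateAt i x))
    ... | no j≢i   = trans (sym (eq j j≢i)) (sym (Vec.lookup∘updateAt′ j i j≢i x))

  flip-~ : ∀ i x → x ~ flip i x
  flip-~ i x = i , lookup-flip-≢ i x ∘ sym , λ j j≢i → sym (Vec.lookup∘updateAt′ j i j≢i x)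

  -- For positive `n` this is the nontrivial automorphism that rules out fewer than two colours.
  opposites : Automorphism (Q n)
  opposites = record
    { bijection = mk↔ₛ′ all-opposite all-opposite involutive involutive
    ; adjacency = λ {x} {y} → mk⇔ (preserves x y) λ e →
        subst₂ _~_ (involutive x) (involutive y) (preserves (all-opposite x) (all-opposite y) e)
    }
    where
    all-opposite : V → V
    all-opposite = Vec.map Fin.opposite

    involutive : ∀ x → all-opposite (all-opposite x) ≡ x
    involutive x = trans (sym (Vec.map-∘ Fin.opposite Fin.opposite x))
      (trans (Vec.map-cong Fin.opposite-involutive x) (Vec.map-id x))

    opposite-injective : ∀ {a b : Fin 2} → Fin.opposite a ≡ Fin.opposite b → a ≡ b
    opposite-injective eq = trans (sym (Fin.opposite-involutive _))
      (trans (cong Fin.opposite eq) (Fin.opposite-involutive _))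

    preserves : ∀ x y → x ~ y → all-opposite x ~ all-opposite y
    preserves x y (i , x≢y , eq) = i ,
      (λ e → x≢y (opposite-injective (trans (sym (Vec.lookup-map i _ x)) (trans e (Vec.lookup-map i _ y))))) ,
      (λ j j≢i → trans (Vec.lookup-map j _ x) (trans (cong Fin.opposite (eq j j≢i)) (sym (Vec.lookup-map j _ y))))

  -- The vertex whose only 1 is at `i` separates coordinate `i` from all others.
  sameCoordinate : ∀ {i j : Fin n} → (∀ x → lookup x i ≡ lookup x j) → i ≡ j
  sameCoordinate {i} {j} eq with i Fin.≟ j
  ... | yes i≡j = i≡j
  ... | no i≢j  = contradiction
    (trans (eq (flip i 0ⁿ)) (trans (Vec.lookup∘updateAt′ j i (i≢j ∘ sym) 0ⁿ) (sym (eq 0ⁿ))))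
    (lookup-flip-≢ i 0ⁿ)

  Homomorphic : (V → V) → Set
  Homomorphic f = ∀ u v → u ~ v → f u ~ f v

  -- Induction along a geodesic: flipping a bit in which `x` and `y` differ brings `x` one step
  -- closer to `y`, while the image moves along a single edge.
  contraction : ∀ f → Homomorphic f → ∀ d x y → dist x y ≡ d → dist (f x) (f y) ≤ d
  contraction f hom zero x y eq =
    ℕ.≤-reflexive (trans (cong (λ y → dist (f x) (f y)) (sym (dist≡0⇒≡ x y eq))) (dist-refl (f x)))
  contraction f hom (suc d) x y eq
    with Fin.any? (λ i → ¬? (lookup x i Fin.≟ lookup y i))
  ... | no agree = contradiction (trans (sym eq) (trans (cong (dist x) (sym x≡y)) (dist-refl x))) λ ()
    where
    x≡y : x ≡ y
    x≡y = lookup-ext λ i → decidable-stable (lookup x i Fin.≟ lookup y i) λ neq → agree (i , neq)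
  ... | yes (i , neq)
    with j , fx≡ ← ~⇒flip (f (flip i x)) (f x) (~-sym {f x} {f (flip i x)} (hom _ _ (flip-~ i x)))
    = ℕ.≤-trans (ℕ.≤-reflexive (cong (λ v → dist v (f y)) fx≡))
        (ℕ.≤-trans (dist-flip-≤ j (f (flip i x)) (f y))
          (s≤s (contraction f hom d (flip i x) y
            (ℕ.suc-injective (trans (sym (dist-flip-differ i x y neq)) eq)))))

  module _ (f g : V → V) (g∘f : ∀ v → g (f v) ≡ v) (f∘g : ∀ v → f (g v) ≡ v)
           (hom : Homomorphic f) (hom⁻¹ : Homomorphic g) where

    isometry : ∀ x y → dist (f x) (f y) ≡ dist x y
    isometry x y = ℕ.≤-antisym (contraction f hom _ x y refl)
      (subst₂ (λ u v → dist u v ≤ dist (f x) (f y)) (g∘f x) (g∘f y)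
        (contraction g hom⁻¹ _ (f x) (f y) refl))

    -- The bit of x in direction c is read off from which of p and its
    -- neighbour flip c p is closer to x.
    agreement : ∀ {p p′ c c′} → f p ≡ p′ → f (flip c p) ≡ flip c′ p′ →
                ∀ x → lookup p c ≡ lookup x c → lookup p′ c′ ≡ lookup (f x) c′
    agreement {p} {p′} {c} {c′} fp fq x eq =
      decidable-stable (lookup p′ c′ Fin.≟ lookup (f x) c′) λ neq →
        ℕ.<-irrefl (trans (dist-flip-differ c′ p′ (f x) neq) (cong suc farther)) (ℕ.n≤1+n _)
      where
      farther : dist (flip c′ p′) (f x) ≡ suc (dist p′ (f x))
      farther = begin
        dist (flip c′ p′) (f x)     ≡⟨ cong (λ v → dist v (f x)) fq ⟨
        dist (f (flip c p)) (f x)   ≡⟨ isometry _ x ⟩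
        dist (flip c p) x           ≡⟨ dist-flip-agree c p x eq ⟩
        suc (dist p x)              ≡⟨ cong suc (isometry p x) ⟨
        suc (dist (f p) (f x))      ≡⟨ cong (λ v → suc (dist v (f x))) fp ⟩
        suc (dist p′ (f x))         ∎
        where open ≡-Reasoning

    -- The image of one edge at a fixed vertex determines what `f` does to an entire coordinate,
    -- since `f` is an isometry.
    coordinate : ∀ {p c c′} → f p ≡ p → f (flip c p) ≡ flip c′ p → lookup p c ≡ lookup p c′ →
                 ∀ x → lookup (f x) c′ ≡ lookup x c
    coordinate {p} {c} {c′} fp fq pc x with lookup p c Fin.≟ lookup x c
    ... | yes eq = trans (sym (agreement fp fq x eq)) (trans (sym pc) eq)
    -- Now `x` agrees in direction `c` with the other end `flip c p` of the edge, so that end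
    -- becomes the base point.
    ... | no neq = begin
      lookup (f x) c′          ≡⟨ agreement fq fp′ x (trans (Vec.lookup∘updateAt c p) (sym (≢⇒≡opposite neq))) ⟨
      lookup (flip c′ p) c′    ≡⟨ Vec.lookup∘updateAt c′ p ⟩
      Fin.opposite (lookup p c′) ≡⟨ cong Fin.opposite pc ⟨
      Fin.opposite (lookup p c)  ≡⟨ ≢⇒≡opposite neq ⟨
      lookup x c               ∎
      where
      open ≡-Reasoning
      fp′ : f (flip c (flip c p)) ≡ flip c′ (flip c′ p)
      fp′ = trans (cong f (flip-involutive c p)) (trans fp (sym (flip-involutive c′ p)))

    -- Fixing `0ⁿ` makes `f` permute its neighbours, hence carry each coordinate `c` to some `c′`;
    -- the second hypothesis forces `c′` to be `c`.
    identity : f 0ⁿ ≡ 0ⁿ → (∀ c c′ → (∀ x → lookup (f x) c′ ≡ lookup x c) → c ≡ c′) → ∀ x → f x ≡ x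
    identity f0 rigid x = lookup-ext λ c →
      let c′ , eq = ~⇒flip _ _ (hom _ _ (flip-~ c 0ⁿ))
          moved   = coordinate {0ⁿ} {c} {c′} f0 (trans eq (cong (flip c′) f0))
                      (trans (Vec.lookup-replicate c zero) (sym (Vec.lookup-replicate c′ zero)))
      in trans (cong (lookup (f x)) (rigid c c′ moved)) (moved x)

-- The rigid edge set

-- stair m j = 1ʲ 0ᵐ⁻ʲ for j ≤ m
stair : ∀ m → ℕ → Vec (Fin 2) m
stair zero    _       = []
stair (suc m) zero    = zero ∷ stair m zero
stair (suc m) (suc j) = suc zero ∷ stair m j

stair-zero : ∀ m → stair m 0 ≡ replicate m zero
stair-zero zero    = refl
stair-zero (suc m) = cong (zero ∷_) (stair-zero m)

-- The bounds matter: `stair m` is constant from `m` onwards.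
stair-injective : ∀ {m i j} → i ≤ m → j ≤ m → stair m i ≡ stair m j → i ≡ j
stair-injective z≤n     z≤n     _  = refl
stair-injective z≤n     (s≤s _) ()
stair-injective (s≤s _) z≤n     ()
stair-injective (s≤s p) (s≤s q) eq = cong suc (stair-injective p q (Vec.∷-injectiveʳ eq))

flip-stair : ∀ {m} (i : Fin m) → flip i (stair m (toℕ i)) ≡ stair m (suc (toℕ i))
flip-stair zero    = refl
flip-stair (suc i) = cong (suc zero ∷_) (flip-stair i)

module Construction (m₀ k : ℕ) (k≤2^m : k ≤ 2 ^ (3 + m₀)) where

  -- The form `3 + m₀` exposes three leading bits: one for the first step of the path and one for
  -- each pendant edge.
  m n : ℕ
  m = 3 + m₀
  n = m + k

  open FiniteGraph (Q n)

  -- Column c of the matrix with these rows is the binary expansion of c.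
  row : Fin m → Vec (Fin 2) k
  row i = tabulate λ c → Fin.finToFun (Fin.inject≤ c k≤2^m) i

  -- `funToFin` inverts the digit expansion, so equal columns come from equal numbers.
  columns-distinct : ∀ c c′ → (∀ i → lookup (row i) c ≡ lookup (row i) c′) → c ≡ c′
  columns-distinct c c′ eq = Fin.inject≤-injective k≤2^m k≤2^m c c′
    (trans (sym (Fin.funToFin-finToFin {m} code))
      (trans (funToFin-cong m λ i → trans (sym (Vec.lookup∘tabulate _ c)) (trans (eq i) (Vec.lookup∘tabulate _ c′)))
        (Fin.funToFin-finToFin {m} code′)))
    where
    code code′ : Fin (2 ^ m)
    code  = Fin.inject≤ c k≤2^m
    code′ = Fin.inject≤ c′ k≤2^m

    funToFin-cong : ∀ m {h h′ : Fin m → Fin 2} → (∀ i → h i ≡ h′ i) → Fin.funToFin h ≡ Fin.funToFin h′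
    funToFin-cong zero    _  = refl
    funToFin-cong (suc m) eq = cong₂ Fin.combine (eq zero) (funToFin-cong m (eq ∘ suc))

  0ᵏ : Vec (Fin 2) k
  0ᵏ = replicate k zero

  path : ℕ → V
  path j = stair m j ++ 0ᵏ

  pendant : Fin 2 → Vec (Fin 2) m
  pendant zero       = zero ∷ suc zero ∷ zero ∷ stair m₀ 0
  pendant (suc zero) = zero ∷ zero ∷ suc zero ∷ stair m₀ 0

  stair≢pendant : ∀ j p → stair m j ≢ pendant p
  stair≢pendant zero    zero       ()
  stair≢pendant zero    (suc zero) ()
  stair≢pendant (suc j) zero       ()
  stair≢pendant (suc j) (suc zero) ()

  rung : (Fin m → Vec (Fin 2) k) → Fin m → V × V
  rung z i = stair m (toℕ i) ++ z i , stair m (suc (toℕ i)) ++ z i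

  pendantEdge : Fin 2 → V × V
  pendantEdge p = path 0 , pendant p ++ 0ᵏ

  -- When `row i` is zero the translate repeats a path edge, so the length only bounds the number of
  -- marked edges from above.
  edges : List (V × V)
  edges = List.map (rung λ _ → 0ᵏ) (List.allFin m) List.++
          List.map (rung row) (List.allFin m) List.++
          List.map pendantEdge (List.allFin 2)

  length-edges : length edges ≡ m + (m + 2)
  length-edges = begin
    length edges
      ≡⟨ List.length-++ (List.map (rung λ _ → 0ᵏ) (List.allFin m)) ⟩
    length (List.map (rung λ _ → 0ᵏ) (List.allFin m)) + _
      ≡⟨ cong₂ _+_ (length-map-allFin (rung λ _ → 0ᵏ)) (List.length-++ (List.map (rung row) (List.allFin m))) ⟩
    m + (length (List.map (rung row) (List.allFin m)) + 2)
      ≡⟨ cong (λ l → m + (l + 2)) (length-map-allFin (rung row)) ⟩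
    m + (m + 2) ∎
    where
    open ≡-Reasoning
    length-map-allFin : ∀ {m} (h : Fin m → V × V) → length (List.map h (List.allFin m)) ≡ m
    length-map-allFin {m} h = trans (List.length-map h (List.allFin m)) (List.length-tabulate {n = m} id)

  -- Neighbours in the marked subgraph

  infix 4 _—_
  _—_ : V → V → Set
  _—_ = Marked (Q n) edges

  data Edge (u v : V) : Set where
    rungᵉ    : ∀ i z → z ≡ 0ᵏ ⊎ z ≡ row i →
               u ≡ stair m (toℕ i) ++ z → v ≡ stair m (suc (toℕ i)) ++ z → Edge u v
    pendantᵉ : ∀ p → u ≡ path 0 → v ≡ pendant p ++ 0ᵏ → Edge u v

  ∈-edges⁻ : ∀ {u v} → (u , v) ∈ edges → Edge u v
  ∈-edges⁻ e with ∈-++⁻ (List.map (rung λ _ → 0ᵏ) (List.allFin m)) e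
  ... | inj₁ e₁ with i , _ , refl ← ∈-map⁻ (rung λ _ → 0ᵏ) {xs = List.allFin m} e₁ 
      = rungᵉ i 0ᵏ (inj₁ refl) refl refl
  ... | inj₂ e₂ with ∈-++⁻ (List.map (rung row) (List.allFin m)) e₂
  ... | inj₁ e₃ with i , _ , refl ← ∈-map⁻ (rung row) {xs = List.allFin m} e₃ 
      = rungᵉ i (row i) (inj₂ refl) refl refl
  ... | inj₂ e₄ with p , _ , refl ← ∈-map⁻ pendantEdge {xs = List.allFin 2} e₄ = pendantᵉ p refl refl

  path-edge : ∀ i → path (toℕ i) — path (suc (toℕ i))
  path-edge i = inj₁ (∈-++⁺ˡ (∈-map⁺ (rung λ _ → 0ᵏ) (∈-allFin i)))

  row-edge : ∀ i → stair m (toℕ i) ++ row i — stair m (suc (toℕ i)) ++ row i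
  row-edge i = inj₁ (∈-++⁺ʳ (List.map (rung λ _ → 0ᵏ) (List.allFin m))
    (∈-++⁺ˡ (∈-map⁺ (rung row) (∈-allFin i))))

  pendant-edge : ∀ p → path 0 — pendant p ++ 0ᵏ
  pendant-edge p = inj₁ (∈-++⁺ʳ (List.map (rung λ _ → 0ᵏ) (List.allFin m))
    (∈-++⁺ʳ (List.map (rung row) (List.allFin m)) (∈-map⁺ pendantEdge (∈-allFin p))))

  data StairNeighbour (j : ℕ) (z : Vec (Fin 2) k) (b : V) : Set where
    up   : ∀ (i : Fin m) → toℕ i ≡ j → z ≡ 0ᵏ ⊎ z ≡ row i → b ≡ stair m (suc j) ++ z → StairNeighbour j z b
    down : ∀ (i : Fin m) → suc (toℕ i) ≡ j → b ≡ stair m (toℕ i) ++ z → StairNeighbour j z b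
    leaf : ∀ p → j ≡ 0 → z ≡ 0ᵏ → b ≡ pendant p ++ 0ᵏ → StairNeighbour j z b

  stair-neighbour : ∀ {j z b} → j ≤ m → stair m j ++ z — b → StairNeighbour j z b
  stair-neighbour {j} {z} j≤m (inj₁ e) with ∈-edges⁻ e
  ... | rungᵉ i z′ choice u≡ v≡
      with refl ← stair-injective j≤m (Fin.toℕ≤n i) (Vec.++-injectiveˡ (stair m j) _ u≡)
         | refl ← Vec.++-injectiveʳ (stair m j) (stair m (toℕ i)) u≡
      = up i refl choice v≡
  ... | pendantᵉ p u≡ v≡ =
      leaf p (stair-injective j≤m z≤n (Vec.++-injectiveˡ (stair m j) _ u≡))
        (Vec.++-injectiveʳ (stair m j) (stair m 0) u≡) v≡
  stair-neighbour {j} {z} j≤m (inj₂ e) with ∈-edges⁻ e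
  ... | rungᵉ i z′ choice u≡ v≡
      with refl ← stair-injective j≤m (Fin.toℕ<n i) (Vec.++-injectiveˡ (stair m j) _ v≡)
         | refl ← Vec.++-injectiveʳ (stair m j) (stair m (suc (toℕ i))) v≡
      = down i refl u≡
  ... | pendantᵉ p u≡ v≡ =
      contradiction (Vec.++-injectiveˡ (stair m j) _ v≡) (stair≢pendant j p)

  pendant-neighbour : ∀ {p b} → pendant p ++ 0ᵏ — b → b ≡ path 0
  pendant-neighbour {p} (inj₁ e) with ∈-edges⁻ e
  ... | rungᵉ i _ _ u≡ _ = contradiction (sym (Vec.++-injectiveˡ (pendant p) _ u≡)) (stair≢pendant (toℕ i) p)
  ... | pendantᵉ _ u≡ _ = contradiction (sym (Vec.++-injectiveˡ (pendant p) _ u≡)) (stair≢pendant 0 p)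
  pendant-neighbour {p} (inj₂ e) with ∈-edges⁻ e
  ... | rungᵉ i _ _ _ v≡ = contradiction (sym (Vec.++-injectiveˡ (pendant p) _ v≡))
                                        (stair≢pendant (suc (toℕ i)) p)
  ... | pendantᵉ _ u≡ _ = u≡

  flip-rung : ∀ i z → flip (i Fin.↑ˡ k) (stair m (toℕ i) ++ z) ≡ stair m (suc (toℕ i)) ++ z
  flip-rung i z = trans (flip-++ˡ i (stair m (toℕ i)) z) (cong (_++ z) (flip-stair i))

  edges-adjacent : ∀ {u v} → Edge u v → u ~ v
  edges-adjacent (rungᵉ i z _ refl refl) =
    subst (stair m (toℕ i) ++ z ~_) (flip-rung i z) (flip-~ (i Fin.↑ˡ k) (stair m (toℕ i) ++ z))
  edges-adjacent (pendantᵉ zero refl refl) = flip-~ (suc zero) (path 0)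
  edges-adjacent (pendantᵉ (suc zero) refl refl) = flip-~ (suc (suc zero)) (path 0)

  AtMostTwoNeighbours : V → Set
  AtMostTwoNeighbours t = ∃[ p ] ∃[ q ] (∀ {b} → t — b → b ≡ p ⊎ b ≡ q)

  stair-twoNeighbours : ∀ {j z} → j ≤ m → stair m j ++ z ≢ path 0 → AtMostTwoNeighbours (stair m j ++ z)
  -- At the ends one candidate is a filler: `pred 0` is 0 where no `down` exists, and `suc m`
  -- exceeds the range where no `up` exists.
  stair-twoNeighbours {j} {z} j≤m t≢ = stair m (suc j) ++ z , stair m (pred j) ++ z , neighbours
    where
    neighbours : ∀ {b} → stair m j ++ z — b → b ≡ stair m (suc j) ++ z ⊎ b ≡ stair m (pred j) ++ z
    neighbours e with stair-neighbour j≤m e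
    ... | up _ _ _ b≡       = inj₁ b≡
    ... | down i refl b≡    = inj₂ b≡
    ... | leaf p refl refl _ = contradiction refl t≢

  pendant-twoNeighbours : ∀ p → AtMostTwoNeighbours (pendant p ++ 0ᵏ)
  pendant-twoNeighbours p = path 0 , path 0 , λ e → inj₁ (pendant-neighbour {p} e)

  twoNeighbours : ∀ {t a} → t ≢ path 0 → t — a → AtMostTwoNeighbours t
  twoNeighbours t≢ (inj₁ e) with ∈-edges⁻ e
  ... | rungᵉ i _ _ refl _ = stair-twoNeighbours (Fin.toℕ≤n i) t≢
  ... | pendantᵉ _ t≡ _    = contradiction t≡ t≢
  twoNeighbours t≢ (inj₂ e) with ∈-edges⁻ e
  ... | rungᵉ i _ _ _ refl = stair-twoNeighbours (Fin.toℕ<n i) t≢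
  ... | pendantᵉ p _ refl  = pendant-twoNeighbours p

  -- Any other vertex has at most two candidates for its neighbours, so two of the three would
  -- coincide.
  threeNeighbours⇒start : ∀ {t a b c} → t — a → t — b → t — c → a ≢ b → a ≢ c → b ≢ c → t ≡ path 0
  threeNeighbours⇒start {t} ta tb tc a≢b a≢c b≢c with t ≟ path 0
  ... | yes t≡ = t≡
  ... | no t≢ with _ , _ , only ← twoNeighbours t≢ ta with only ta | only tb | only tc
  ... | inj₁ refl | inj₁ refl | _         = contradiction refl a≢b
  ... | inj₂ refl | inj₂ refl | _         = contradiction refl a≢b
  ... | inj₁ refl | inj₂ _    | inj₁ refl = contradiction refl a≢c
  ... | inj₂ refl | inj₁ _    | inj₂ refl = contradiction refl a≢c
  ... | inj₁ _    | inj₂ refl | inj₂ refl = contradiction refl b≢c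
  ... | inj₂ _    | inj₁ refl | inj₁ refl = contradiction refl b≢c

  -- Symmetries of the marked subgraph

  module _ {f g : V → V} (s : Symmetry (Q n) edges f g) where
    open Symmetry s

    injective : ∀ {u v} → f u ≡ f v → u ≡ v
    injective eq = trans (sym (g∘f _)) (trans (cong g eq) (g∘f _))

    move : ∀ {u v} → u — v → f u — f v
    move {u} {v} (inj₁ e) = proj₂ (keeps u v (edges-adjacent (∈-edges⁻ e))) (inj₁ e)
    move {u} {v} (inj₂ e) =
      Sum.swap (proj₂ (keeps v u (edges-adjacent (∈-edges⁻ e))) (inj₁ e))

    start-fixed : f (path 0) ≡ path 0
    start-fixed = threeNeighbours⇒start
      (move (path-edge zero)) (move (pendant-edge zero)) (move (pendant-edge (suc zero)))
      ((λ ()) ∘ injective) ((λ ()) ∘ injective) ((λ ()) ∘ injective)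

    path-injective : ∀ {i j} → i ≤ m → j ≤ m → path i ≡ path j → i ≡ j
    path-injective {i} {j} i≤m j≤m eq =
      stair-injective i≤m j≤m (Vec.++-injectiveˡ (stair m i) (stair m j) eq)

    path-fixed : ∀ j → j ≤ m → f (path j) ≡ path j
    path-fixed zero _ = start-fixed
    path-fixed (suc zero) _
      with stair-neighbour z≤n (subst (_— f (path 1)) start-fixed (move (path-edge zero)))
    ... | up _ _ _ eq   = eq
    ... | down _ () _
    -- Were `path 1` sent to a pendant vertex, `path 2` would have to go to the only neighbour of
    -- that vertex, `path 0`, which is already the image of itself.
    ... | leaf p _ _ eq = contradiction (injective (trans 2↦0 (sym start-fixed))) λ ()
      where
      2↦0 : f (path 2) ≡ path 0
      2↦0 = pendant-neighbour {p} (subst (_— f (path 2)) eq (move (path-edge (suc zero))))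
    path-fixed (suc (suc j)) 2+j≤m
      with stair-neighbour 1+j≤m (subst (_— f (path (2 + j))) (path-fixed (suc j) 1+j≤m) (move edge))
      where
      1+j≤m : suc j ≤ m
      1+j≤m = ℕ.<⇒≤ 2+j≤m

      edge : path (suc j) — path (2 + j)
      edge = subst (λ i → path i — path (suc i)) (Fin.toℕ-fromℕ< 2+j≤m) (path-edge (Fin.fromℕ< 2+j≤m))
    ... | up _ _ _ eq      = eq
    -- Turning back would give `path (2 + j)` the same image as `path j`.
    ... | down _ i≡ eq     = contradiction
      (path-injective 2+j≤m j≤m (injective
        (trans eq (trans (cong path (ℕ.suc-injective i≡)) (sym (path-fixed j j≤m))))))
      (ℕ.m+1+n≢n 1)
      where
      j≤m : j ≤ m
      j≤m = ℕ.≤-trans (ℕ.m≤n+m j 2) 2+j≤m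

    -- The path is fixed pointwise and has an edge in each of the first `m` directions, so
    -- `coordinate` applies with equal directions.
    prefix-fixed : ∀ i x → lookup (f x) (i Fin.↑ˡ k) ≡ lookup x (i Fin.↑ˡ k)
    prefix-fixed i = coordinate f g g∘f f∘g (λ u v → proj₁ ∘ keeps u v) (λ u v → proj₁ ∘ keeps⁻¹ u v)
      (path-fixed (toℕ i) (Fin.toℕ≤n i))
      (trans (cong f (flip-rung i 0ᵏ)) (trans (path-fixed _ (Fin.toℕ<n i)) (sym (flip-rung i 0ᵏ))))
      refl

    image-++ : ∀ w z → ∃[ z′ ] (f (w ++ z) ≡ w ++ z′)
    image-++ w z with Vec.splitAt m (f (w ++ z))
    ... | w′ , z′ , eq = z′ , trans eq (cong (_++ z′) (lookup-ext λ i → begin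
      lookup w′ i                        ≡⟨ Vec.lookup-++ˡ w′ z′ i ⟨
      lookup (w′ ++ z′) (i Fin.↑ˡ k)     ≡⟨ cong (λ v → lookup v (i Fin.↑ˡ k)) eq ⟨
      lookup (f (w ++ z)) (i Fin.↑ˡ k)   ≡⟨ prefix-fixed i (w ++ z) ⟩
      lookup (w ++ z) (i Fin.↑ˡ k)       ≡⟨ Vec.lookup-++ˡ w z i ⟩
      lookup w i                         ∎))
      where open ≡-Reasoning

    -- Both ends keep their prefixes, so the image is again a rung in direction `i`, with suffix
    -- `0ᵏ` or `row i`.
    row-fixed : ∀ i → let v = stair m (toℕ i) ++ row i in f v ≡ v
    row-fixed i with image-++ (stair m (toℕ i)) (row i) | image-++ (stair m (suc (toℕ i))) (row i)
    ... | z , lower≡ | z′ , upper≡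
      with stair-neighbour (Fin.toℕ≤n i) (subst₂ _—_ lower≡ upper≡ (move (row-edge i)))
    -- The image would be a path vertex, which is its own image; injectivity then makes the two
    -- vertices equal.
    ... | up i′ i′≡i (inj₁ refl) _ =
      trans lower≡ (sym (injective (trans lower≡ (sym (path-fixed _ (Fin.toℕ≤n i))))))
    ... | up i′ i′≡i (inj₂ refl) _ =
      trans lower≡ (cong (λ i′ → stair m (toℕ i) ++ row i′) (Fin.toℕ-injective i′≡i))
    ... | down i′ 1+i′≡i eq = contradiction
      (trans (cong suc 1+i′≡i) (stair-injective (Fin.toℕ<n i) (Fin.toℕ≤n i′)
        (Vec.++-injectiveˡ (stair m (suc (toℕ i))) (stair m (toℕ i′)) eq)))
      (ℕ.m+1+n≢n 1)
    ... | leaf p _ _ eq = contradiction (Vec.++-injectiveˡ (stair m (suc (toℕ i))) (pendant p) eq)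
                                        (stair≢pendant (suc (toℕ i)) p)

    coordinates-distinguished : ∀ c c′ → (∀ x → lookup (f x) c′ ≡ lookup x c) → c ≡ c′
    coordinates-distinguished c c′ eq
      with Fin.splitAt m c in c≡ | Fin.splitAt m c′ in c′≡
    ... | _ | inj₁ i′ with refl ← Fin.splitAt⁻¹-↑ˡ {m} {k} {c′} c′≡ =
      sameCoordinate λ x → trans (sym (eq x)) (prefix-fixed i′ x)
    -- Coordinates `c` and `c′` agree on every `f x`, and `f` is onto, so they agree everywhere.
    ... | inj₁ i | inj₂ _ with refl ← Fin.splitAt⁻¹-↑ˡ {m} {k} {c} c≡ =
      sameCoordinate λ y → begin
        lookup y c           ≡⟨ cong (λ v → lookup v c) (f∘g y) ⟨
        lookup (f (g y)) c   ≡⟨ prefix-fixed i (g y) ⟩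
        lookup (g y) c       ≡⟨ eq (g y) ⟨
        lookup (f (g y)) c′  ≡⟨ cong (λ v → lookup v c′) (f∘g y) ⟩
        lookup y c′          ∎
      where open ≡-Reasoning
    -- Evaluating at the fixed vertex with suffix `row i`, for each `i`, shows that columns `d` and
    -- `d′` are equal.
    ... | inj₂ d | inj₂ d′
      with refl ← Fin.splitAt⁻¹-↑ʳ {m} {k} {c} c≡
         | refl ← Fin.splitAt⁻¹-↑ʳ {m} {k} {c′} c′≡ =
      cong (m Fin.↑ʳ_) (columns-distinct d d′ λ i → let w = stair m (toℕ i) in begin
        lookup (row i) d                      ≡⟨ Vec.lookup-++ʳ w (row i) d ⟨
        lookup (w ++ row i) (m Fin.↑ʳ d)      ≡⟨ eq (w ++ row i) ⟨
        lookup (f (w ++ row i)) (m Fin.↑ʳ d′) ≡⟨ cong (λ v → lookup v (m Fin.↑ʳ d′)) (row-fixed i) ⟩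
        lookup (w ++ row i) (m Fin.↑ʳ d′)     ≡⟨ Vec.lookup-++ʳ w (row i) d′ ⟩
        lookup (row i) d′                     ∎)
      where open ≡-Reasoning

  path-0 : path 0 ≡ 0ⁿ
  path-0 = trans (cong (_++ 0ᵏ) (stair-zero m)) (zeros m)
    where
    zeros : ∀ m → replicate m zero ++ 0ᵏ ≡ replicate (m + k) (zero {1})
    zeros zero    = refl
    zeros (suc m) = cong (zero ∷_) (zeros m)

  edges-rigid : Rigid (Q n) edges
  edges-rigid f g s = identity f g g∘f f∘g (λ u v → proj₁ ∘ keeps u v) (λ u v → proj₁ ∘ keeps⁻¹ u v)
    (subst (λ v → f v ≡ v) path-0 (path-fixed s 0 z≤n)) (coordinates-distinguished s)
    where open Symmetry s

  cost-bound : ∃[ r ] (EdgeDistinguishingCost (Q n) r × r ≤ m + (m + 2))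
  cost-bound =
    let r , cost , r≤ = cost-≤ (Q n) opposites (0ⁿ , λ ()) edges edges-rigid
    in r , cost , ℕ.≤-trans r≤ (ℕ.≤-reflexive length-edges)

-- Logarithm estimates and the numerical bound

n≤2^⌈log₂n⌉ : ∀ n → n ≤ 2 ^ ⌈log₂ n ⌉
n≤2^⌈log₂n⌉ n = go n (<-wellFounded n)
  where
  -- The accessibility proof is kept general because `⌈log2⌉` recurses on it, passing from `n` to
  -- `⌈ n /2⌉`.
  go : ∀ n (rec : Acc _<_ n) → n ≤ 2 ^ ⌈log2⌉ n rec
  go zero          _        = z≤n
  go (suc zero)    _        = ℕ.≤-refl
  go n@(suc (suc n₀)) (acc rs) = begin
    n                              ≡⟨ ℕ.⌊n/2⌋+⌈n/2⌉≡n n ⟨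
    ⌊ n /2⌋ + ⌈ n /2⌉              ≤⟨ ℕ.+-monoˡ-≤ _ (ℕ.⌊n/2⌋≤⌈n/2⌉ n) ⟩
    ⌈ n /2⌉ + ⌈ n /2⌉              ≡⟨ cong (⌈ n /2⌉ +_) (ℕ.+-identityʳ _) ⟨
    2 * ⌈ n /2⌉                    ≤⟨ ℕ.*-monoʳ-≤ 2 (go ⌈ n /2⌉ _) ⟩
    2 ^ ⌈log2⌉ n (acc rs)          ∎
    where open ℕ.≤-Reasoning

n≤2^n : ∀ n → n ≤ 2 ^ n
n≤2^n zero    = z≤n
n≤2^n (suc n) = ℕ.+-mono-≤ (ℕ.m^n>0 2 n) (ℕ.≤-trans (n≤2^n n) (ℕ.m≤m+n _ 0))

⌈log₂n⌉≤n : ∀ n → ⌈log₂ n ⌉ ≤ n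
⌈log₂n⌉≤n n = ℕ.≤-trans (⌈log₂⌉-mono-≤ (n≤2^n n)) (ℕ.≤-reflexive (⌈log₂2^n⌉≡n n))

cost-bound-of-size : ∀ m n → 3 ≤ m → m ≤ n → n ≤ 2 ^ m →
  ∃[ r ] (EdgeDistinguishingCost (Q n) r × r ≤ 4 * m ∸ 2)
cost-bound-of-size m@(suc (suc (suc m₀))) n (s≤s (s≤s (s≤s _))) m≤n n≤2^m =
  subst (λ n → ∃[ r ] (EdgeDistinguishingCost (Q n) r × r ≤ 4 * m ∸ 2)) (ℕ.m+[n∸m]≡n m≤n)
    (let r , cost , r≤ = Construction.cost-bound m₀ (n ∸ m) (ℕ.≤-trans (ℕ.m∸n≤m n m) n≤2^m)
     in r , cost , ℕ.≤-trans r≤ (ℕ.m+n≤o⇒m≤o∸n _ bound))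
  where
  -- Adding 2 on the left replaces the truncated subtraction; the claim becomes
  -- `10 + 2 * m₀ ≤ 12 + 4 * m₀`.
  bound : m + (m + 2) + 2 ≤ 4 * m
  bound = begin
    m + (m + 2) + 2
      ≡⟨ solve 1 (λ a → (con 3 :+ a) :+ ((con 3 :+ a) :+ con 2) :+ con 2 := con 10 :+ con 2 :* a) refl m₀ ⟩
    10 + 2 * m₀        ≤⟨ ℕ.+-mono-≤ (ℕ.m≤m+n 10 2) (ℕ.*-monoˡ-≤ m₀ {2} {4} (s≤s (s≤s z≤n))) ⟩
    12 + 4 * m₀        ≡⟨ solve 1 (λ a → con 12 :+ con 4 :* a := con 4 :* (con 3 :+ a)) refl m₀ ⟩
    4 * m              ∎
    where
    open ℕ.≤-Reasoning
    open +-*-Solver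

theorem5p11 : ∀ (n : ℕ) → 5 ≤ n →
    ∃[ r ] (EdgeDistinguishingCost (Q n) r × r ≤ 4 * ⌈log₂ n ⌉ ∸ 2)
theorem5p11 n 5≤n = cost-bound-of-size ⌈log₂ n ⌉ n
  -- `⌈log₂ 5 ⌉` evaluates to 3, the least prefix length that the construction allows.
  (⌈log₂⌉-mono-≤ 5≤n) (⌈log₂n⌉≤n n) (n≤2^⌈log₂n⌉ n)
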